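{- Let $m$ be an even positive integer. Then there does not exist a set of $2$-maxMOFS$(2m;m)$. Equivalently: for any two orthogonal frequency squares $F_1,F_2$ of type $(2m;m)$, there exists a frequency square $F$ of type $(2m;m)$ that is orthogonal to both $F_1$ and $F_2$.
   Context: A frequency square of type $(n;\lambda)$ (with $\lambda\mid n$) is an $n\times n$ array on the symbol set $\{0,1,\dots,n/\lambda-1\}$ in which each symbol occurs exactly $\lambda$ times in each row and exactly $\lambda$ times in each column. Two frequency squares of type $(n;\lambda)$ are orthogonal if, when superimposed, each ordered pair of symbols $(i,j)$ occurs exactly $\lambda^2$ times. A set of $k$-MOFS$(n;\lambda)$ is a set of $k$ pairwise orthogonal frequency squares of type $(n;\lambda)$; it is maximal (written $k$-maxMOFS$(n;\lambda)$) if there is no frequency square of type $(n;\lambda)$ orthogonal to every square in the set. -}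

module Defs where

open import Data.Nat using (ℕ; suc; _*_; NonZero)
open import Data.Nat.DivMod using (_/_)
open import Data.Fin using (Fin)
open import Data.Fin.Properties using (_≟_)
open import Data.List using (List; length; filter; cartesianProduct)
open import Data.List using () renaming (allFin to allFinL)
open import Data.Product using (_×_; _,_; proj₁; proj₂)
open import Relation.Binary.PropositionalEquality using (_≡_)
open import Relation.Nullary.Decidable using (_×-dec_)

Array : ℕ → ℕ → Set
Array n k = Fin n → Fin n → Fin k

count : ∀ {n k} → (Fin n → Fin k) → Fin k → ℕ
count {n} f s = length (filter (λ j → f j ≟ s) (allFinL n))

-- Frequency square of type (n;λ): symbols {0,…,n/λ-1}, each symbol occurs
-- exactly λ times in each row and each column.
-- (λ ∣ n is imposed separately in the statement where needed.)
IsFreqSquare : (n l : ℕ) .{{_ : NonZero l}} → Array n (n / l) → Set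
IsFreqSquare n l F =
  (∀ (r : Fin n) (s : Fin (n / l)) → count (λ c → F r c) s ≡ l) ×
  (∀ (c : Fin n) (s : Fin (n / l)) → count (λ r → F r c) s ≡ l)

pairCount : ∀ {n k} → Array n k → Array n k → Fin k → Fin k → ℕ
pairCount {n} F G i j =
  length (filter (λ rc → (F (proj₁ rc) (proj₂ rc) ≟ i) ×-dec (G (proj₁ rc) (proj₂ rc) ≟ j))
                 (cartesianProduct (allFinL n) (allFinL n)))

Orthogonal : (n l : ℕ) .{{_ : NonZero l}} → Array n (n / l) → Array n (n / l) → Set
Orthogonal n l F G = ∀ (i j : Fin (n / l)) → pairCount F G i j ≡ l * l

{-# OPTIONS --safe #-}

-- Regard the cell (r , c) as an edge joining the pair (row r, symbol F₁ r c) to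
-- the pair (column c, symbol F₂ r c).  This bipartite multigraph is m-regular,
-- and m is even, so it has an Eulerian orientation.  Let F record the direction
-- of each edge.  Then F takes both values equally often on the cells of any row
-- with a given symbol in F₁, and on the cells of any column with a given symbol
-- in F₂.  Hence F is a frequency square, and it is orthogonal to F₁ by summing
-- over rows and to F₂ by summing over columns.

module Submission where

open import Defs
open import Data.Nat using (ℕ; suc; _*_; NonZero)
open import Data.Nat.DivMod using (_/_)
open import Data.Product using (_×_; Σ)

open import Data.Bool using (Bool; true; false; not; _∧_; if_then_else_)
open import Data.Fin using (Fin; zero; suc; _↑ˡ_; _↑ʳ_; combine; remQuot)
open import Data.Fin.Patterns using (0F; 1F)
open import Data.Fin.Properties using (_≟_; remQuot-combine)
open import Data.List using (length; filter; map; _++_; cartesianProduct; tabulate)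
open import Data.List.Properties using (length-++; filter-++; map-tabulate)
open import Data.Nat using (zero; _+_)
open import Data.Nat.Divisibility using (_∣_; divides; ∣1⇒≡1; ∣m+n∣m⇒∣n; m∣m*n)
open import Data.Nat.DivMod using (m*n/n≡m)
open import Data.Nat.Properties
  using (+-0-commutativeMonoid; +-assoc; +-comm; +-cancelʳ-≡; +-identityʳ; *-cancelˡ-≡)
open import Data.Nat.Tactic.RingSolver using (solve-∀)
open import Data.Product using (∃₂; _,_; proj₁; proj₂; uncurry)
open import Data.Product.Properties using (,-injective)
open import Data.Sum using (_⊎_; inj₁; inj₂)
import Data.Sum.Properties as ⊎
open import Data.Vec.Functional using (Vector; _∷_)
open import Function using (_∘_; id)
open import Level using (0ℓ)
open import Relation.Binary.Definitions using (DecidableEquality)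
open import Relation.Binary.PropositionalEquality
open import Relation.Nullary using (does; yes; no; contradiction)
open import Relation.Nullary.Decidable using (map′; _×-dec_)
open import Relation.Unary using (Pred; Decidable)

open import Algebra.Properties.CommutativeMonoid.Sum +-0-commutativeMonoid
  using (sum; sum-syntax; sum-cong-≗; sum-replicate-zero; ∑-distrib-+; ∑-comm)

open ≡-Reasoning

⟦_⟧ : Bool → ℕ
⟦ b ⟧ = if b then 1 else 0

-- Eulerian orientations of finite multigraphs

module Euler {V : Set} (_≟ᵥ_ : DecidableEquality V) where

  Edge : Set
  Edge = V × V

  δ : V → V → ℕ
  δ w v = ⟦ does (v ≟ᵥ w) ⟧

  tail head : Bool → Edge → V
  tail b e = if b then proj₁ e else proj₂ e
  head b e = tail (not b) e

  -- Both ends are added separately, so a loop contributes two and never affects parity.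
  degree : ∀ {n} → Vector Edge n → V → ℕ
  degree es w = sum λ i → δ w (proj₁ (es i)) + δ w (proj₂ (es i))

  outdegree indegree : ∀ {n} → Vector Bool n → Vector Edge n → V → ℕ
  outdegree xs es w = sum λ i → δ w (tail (xs i) (es i))
  indegree  xs es w = sum λ i → δ w (head (xs i) (es i))

  -- In es′ some edge v—t of es is replaced by u—t; orienting the path u—v—t
  -- like the edge u—t leaves the net flow at every vertex unchanged.  The
  -- equations are arranged so that no subtraction occurs.
  Contraction : ∀ {n} → V → V → Vector Edge n → Set
  Contraction {n} u v es = Σ (Vector Edge n) λ es′ →
    (∀ w → degree es′ w + δ w v ≡ degree es w + δ w u) ×
    (∀ xs′ → ∃₂ λ xs b → ∀ w →
      outdegree xs es w + δ w (tail b (u , v)) + indegree xs′ es′ w ≡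
      indegree xs es w + δ w (head b (u , v)) + outdegree xs′ es′ w)

  -- Scan for the first edge with an end at `v`; since `degree es v` is nonzero, the scan stops
  -- before the edges run out. That edge is the one whose end is moved from `v` to `u`.
  contract   : ∀ {n} u v (es : Vector Edge n) → degree es v ≢ 0 → Contraction u v es
  contract-∷ : ∀ {n} u v e (es : Vector Edge n) →
               degree (e ∷ es) v ≢ 0 → Contraction u v (e ∷ es)

  contract {zero}  u v es deg≢0 = contradiction refl deg≢0
  contract {suc n} u v es deg≢0 = contract-∷ u v (es zero) (es ∘ suc) deg≢0

  contract-∷ u v (a , t) es deg≢0 with a ≟ᵥ v | t ≟ᵥ v
  -- The edge v - t becomes u - t with its ends in the same order, so both edges of the path u - v -
  -- t take the orientation bit of u - t. If the edge is a loop at `v`, only its first end moves.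
  ... | yes refl | _ = (u , t) ∷ es , (λ w → lem (δ w u) (δ w t) (degree es w) (δ w v)) , reorient
    where
    lem : ∀ p q r s → p + q + r + s ≡ s + q + r + p
    lem = solve-∀
    reorient : ∀ xs′ → _
    reorient xs′ = xs′ , xs′ zero , λ w → aux (xs′ zero) w
      where
      O = outdegree (xs′ ∘ suc) es
      I = indegree (xs′ ∘ suc) es
      lem₁ : ∀ p q r i o → p + o + q + (r + i) ≡ r + i + p + (q + o)
      lem₁ = solve-∀
      lem₂ : ∀ p q r i o → r + o + p + (q + i) ≡ p + i + q + (r + o)
      lem₂ = solve-∀
      aux : ∀ b w →
        δ w (tail b (v , t)) + O w + δ w (tail b (u , v)) +
          (δ w (head b (u , t)) + I w) ≡
        δ w (head b (v , t)) + I w + δ w (head b (u , v)) +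
          (δ w (tail b (u , t)) + O w)
      aux true  w = lem₁ (δ w v) (δ w u) (δ w t) (I w) (O w)
      aux false w = lem₂ (δ w v) (δ w u) (δ w t) (I w) (O w)
  -- Now the moved end is the second one. A `true` bit on `(a , u)` directs the path as a, v, u,
  -- which runs against `(u , v)`; hence the `not` in the bit for that edge.
  ... | no _ | yes refl = (a , u) ∷ es , (λ w → lem (δ w a) (δ w u) (degree es w) (δ w v)) , reorient
    where
    lem : ∀ p q r s → p + q + r + s ≡ p + s + r + q
    lem = solve-∀
    reorient : ∀ xs′ → _
    reorient xs′ = xs′ , not (xs′ zero) , λ w → aux (xs′ zero) w
      where
      O = outdegree (xs′ ∘ suc) es
      I = indegree (xs′ ∘ suc) es
      lem₁ : ∀ p q r i o → r + o + p + (q + i) ≡ p + i + q + (r + o)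
      lem₁ = solve-∀
      lem₂ : ∀ p q r i o → p + o + q + (r + i) ≡ r + i + p + (q + o)
      lem₂ = solve-∀
      aux : ∀ b w →
        δ w (tail b (a , v)) + O w + δ w (tail (not b) (u , v)) +
          (δ w (head b (a , u)) + I w) ≡
        δ w (head b (a , v)) + I w + δ w (head (not b) (u , v)) +
          (δ w (tail b (a , u)) + O w)
      aux true  w = lem₁ (δ w v) (δ w u) (δ w a) (I w) (O w)
      aux false w = lem₂ (δ w v) (δ w u) (δ w a) (I w) (O w)
  -- With both tests refuted, the two `δ` terms of this edge at `v` reduce to 0, so `deg≢0` already
  -- has the type needed for the remaining edges.
  ... | no _ | no _ with contract u v es deg≢0
  ... | es′ , deg′ , reorient′ = (a , t) ∷ es′ , deg , reorient
    where
    deg : ∀ w → δ w a + δ w t + degree es′ w + δ w v ≡ δ w a + δ w t + degree es w + δ w u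
    deg w = begin
      δ w a + δ w t + degree es′ w + δ w v   ≡⟨ +-assoc (δ w a + δ w t) _ _ ⟩
      δ w a + δ w t + (degree es′ w + δ w v) ≡⟨ cong (δ w a + δ w t +_) (deg′ w) ⟩
      δ w a + δ w t + (degree es w + δ w u)  ≡⟨ +-assoc (δ w a + δ w t) _ _ ⟨
      δ w a + δ w t + degree es w + δ w u    ∎
    reorient : ∀ xs′ → _
    reorient xs′ with xs , b , flow ← reorient′ (xs′ ∘ suc) = xs′ zero ∷ xs , b , λ w →
      let p = δ w (tail (xs′ zero) (a , t)); q = δ w (head (xs′ zero) (a , t)) in
      trans (lem p q _ _ _) (trans (cong (p + q +_) (flow w)) (sym (lem′ p q _ _ _)))
      where
      lem : ∀ p q o d i → p + o + d + (q + i) ≡ p + q + (o + d + i)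
      lem = solve-∀
      lem′ : ∀ p q o d i → q + o + d + (p + i) ≡ p + q + (o + d + i)
      lem′ = solve-∀

  even-double : ∀ n → 2 ∣ n + n
  even-double n = divides n (solve n)
    where
    solve : ∀ n → n + n ≡ n * 2
    solve = solve-∀

  -- A non-loop edge `(u , v)` adds exactly 1 at `v`; if no other edge met `v`, the total degree
  -- there would be 1, which is odd.
  degree≢0 : ∀ {n u v} (es : Vector Edge n) → u ≢ v → 2 ∣ degree ((u , v) ∷ es) v → degree es v ≢ 0
  degree≢0 {u = u} {v} es u≢v even deg≡0 with u ≟ᵥ v | v ≟ᵥ v
  ... | yes u≡v | _      = u≢v u≡v
  ... | no _    | no v≢v = v≢v refl
  ... | no _    | yes _  rewrite deg≡0 = contradiction (∣1⇒≡1 even) λ ()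

  -- Replacing the path u - v - t by u - t lowers the degree at `v` by two and changes no other
  -- degree, so parity survives at every vertex.
  contract-even : ∀ {n u v} (es es′ : Vector Edge n) w →
                  degree es′ w + δ w v ≡ degree es w + δ w u →
                  2 ∣ degree ((u , v) ∷ es) w → 2 ∣ degree es′ w
  contract-even {u = u} {v} es es′ w deg even = ∣m+n∣m⇒∣n (subst (2 ∣_) eq even) (even-double (δ w v))
    where
    lem₁ : ∀ p q r → p + q + r ≡ q + (r + p)
    lem₁ = solve-∀
    lem₂ : ∀ q r → q + (r + q) ≡ q + q + r
    lem₂ = solve-∀
    eq : δ w u + δ w v + degree es w ≡ δ w v + δ w v + degree es′ w
    eq = begin
      δ w u + δ w v + degree es w      ≡⟨ lem₁ (δ w u) (δ w v) _ ⟩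
      δ w v + (degree es w + δ w u)    ≡⟨ cong (δ w v +_) deg ⟨
      δ w v + (degree es′ w + δ w v)   ≡⟨ lem₂ (δ w v) _ ⟩
      δ w v + δ w v + degree es′ w     ∎

  Eulerian : ∀ {n} → Vector Edge n → Set
  Eulerian {n} es = Σ (Vector Bool n) λ xs → ∀ w → outdegree xs es w ≡ indegree xs es w

  -- Induction on the number of edges: a loop is dropped, and a non-loop edge is merged with another
  -- edge at its end `v`. The recursion is on `n`, because the contracted `es′` is not a tail of the
  -- given edges.
  eulerian   : ∀ {n} (es : Vector Edge n) → (∀ w → 2 ∣ degree es w) → Eulerian es
  eulerian-∷ : ∀ {n} e (es : Vector Edge n) → (∀ w → 2 ∣ degree (e ∷ es) w) → Eulerian (e ∷ es)

  eulerian {zero}  es even = (λ ()) , λ w → refl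
  eulerian {suc n} es even = eulerian-∷ (es zero) (es ∘ suc) even

  eulerian-∷ (u , v) es even with u ≟ᵥ v
  ... | yes refl
    -- A loop adds an even amount to every degree and the same amount to out- and indegree, so its
    -- direction `true` is an arbitrary choice.
    with xs , flow ← eulerian es (λ w → ∣m+n∣m⇒∣n (even w) (even-double (δ w v)))
    = true ∷ xs , λ w → cong (δ w v +_) (flow w)
  ... | no u≢v
    with es′ , deg , reorient ← contract u v es (degree≢0 es u≢v (even v))
    with xs′ , flow′ ← eulerian es′ (λ w → contract-even es es′ w (deg w) (even w))
    with xs , b , flow ← reorient xs′
    = b ∷ xs , balanced
    where
    balanced : ∀ w → outdegree (b ∷ xs) ((u , v) ∷ es) w ≡ indegree (b ∷ xs) ((u , v) ∷ es) w
    -- After adding the outdegree of `es′` to both sides, `flow′` trades it on the left for the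
    -- equal indegree, which gives the shape of `flow`.
    balanced w = +-cancelʳ-≡ (outdegree xs′ es′ w) _ _ (begin
      δ w (tail b (u , v)) + outdegree xs es w + outdegree xs′ es′ w  ≡⟨ cong₂ _+_ (+-comm (δ w (tail b (u , v))) _) (flow′ w) ⟩
      outdegree xs es w + δ w (tail b (u , v)) + indegree xs′ es′ w   ≡⟨ flow w ⟩
      indegree xs es w + δ w (head b (u , v)) + outdegree xs′ es′ w   ≡⟨ cong (_+ outdegree xs′ es′ w) (+-comm _ (δ w (head b (u , v)))) ⟩
      δ w (head b (u , v)) + indegree xs es w + outdegree xs′ es′ w   ∎)

-- Finite sums and counts as sums of indicators

sum-++ : ∀ m {n} (f : Vector ℕ (m + n)) → sum f ≡ sum (f ∘ (_↑ˡ n)) + sum (f ∘ (m ↑ʳ_))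
sum-++ zero    f = refl
sum-++ (suc m) f = trans (cong (f zero +_) (sum-++ m (f ∘ suc))) (sym (+-assoc (f zero) _ _))

sum-combine : ∀ m {n} (f : Vector ℕ (m * n)) → sum f ≡ ∑[ i < m ] ∑[ j < n ] f (combine i j)
sum-combine zero        f = refl
sum-combine (suc m) {n} f = trans (sum-++ n f) (cong (sum {n} (f ∘ (_↑ˡ _)) +_) (sum-combine m (f ∘ (n ↑ʳ_))))

sum-const : ∀ n c → ∑[ i < n ] c ≡ n * c
sum-const zero    c = refl
sum-const (suc n) c = cong (c +_) (sum-const n c)

sum-select : ∀ {n} (f : Vector ℕ n) k → ∑[ i < n ] (if does (i ≟ k) then f i else 0) ≡ f k
sum-select {suc n} f zero    = trans (cong (f zero +_) (sum-replicate-zero n)) (+-identityʳ _)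
sum-select {suc n} f (suc k) = sum-select (f ∘ suc) k

length-filter-tabulate : ∀ {A : Set} {P : Pred A 0ℓ} (P? : Decidable P) {n} (f : Vector A n) →
                         length (filter P? (tabulate f)) ≡ ∑[ i < n ] ⟦ does (P? (f i)) ⟧
length-filter-tabulate P? {zero}  f = refl
length-filter-tabulate P? {suc n} f with does (P? (f zero))
... | true  = cong suc (length-filter-tabulate P? (f ∘ suc))
... | false = length-filter-tabulate P? (f ∘ suc)

length-filter-cartesianProduct :
  ∀ {A B : Set} {P : Pred (A × B) 0ℓ} (P? : Decidable P) {m n} (f : Vector A m) (g : Vector B n) →
  length (filter P? (cartesianProduct (tabulate f) (tabulate g))) ≡
  ∑[ i < m ] ∑[ j < n ] ⟦ does (P? (f i , g j)) ⟧
length-filter-cartesianProduct P? {zero}  f g = refl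
length-filter-cartesianProduct P? {suc m} f g = begin
  length (filter P? (map (f zero ,_) (tabulate g) ++ rest))
    ≡⟨ cong length (filter-++ P? (map (f zero ,_) (tabulate g)) rest) ⟩
  length (filter P? (map (f zero ,_) (tabulate g)) ++ filter P? rest)
    ≡⟨ length-++ (filter P? (map (f zero ,_) (tabulate g))) ⟩
  length (filter P? (map (f zero ,_) (tabulate g))) + length (filter P? rest)
    ≡⟨ cong₂ _+_
         (trans (cong (length ∘ filter P?) (map-tabulate g (f zero ,_)))
                (length-filter-tabulate P? ((f zero ,_) ∘ g)))
         (length-filter-cartesianProduct P? (f ∘ suc) g) ⟩
  sum (λ j → ⟦ does (P? (f zero , g j)) ⟧) +
  ∑[ i < m ] sum (λ j → ⟦ does (P? (f (suc i) , g j)) ⟧)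
    ∎
  where rest = cartesianProduct (tabulate (f ∘ suc)) (tabulate g)

-- Pairs are compared through `×-dec` so that `does` computes to a conjunction, and to `false`
-- across the two sides of `⊎`. Thus `δ` at an end of a cell unfolds by definition to row (or
-- column) test and symbol test.
_≟ᵥ_ : ∀ {n k} → DecidableEquality (Fin n × Fin k ⊎ Fin n × Fin k)
_≟ᵥ_ = ⊎.≡-dec _≟ₚ_ _≟ₚ_
  where
  _≟ₚ_ : ∀ {n k} → DecidableEquality (Fin n × Fin k)
  (r , i) ≟ₚ (s , j) = map′ (uncurry (cong₂ _,_)) ,-injective (r ≟ s ×-dec i ≟ j)

sum-select-col : ∀ {m n} (f : Fin m → Fin n → ℕ) c →
  ∑[ r < m ] ∑[ c′ < n ] (if does (c′ ≟ c) then f r c′ else 0) ≡ ∑[ r < m ] f r c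
sum-select-col f c = sum-cong-≗ λ r → sum-select (f r) c

sum-select-row : ∀ {m n} (f : Fin m → Fin n → ℕ) r →
  ∑[ r′ < m ] ∑[ c < n ] (if does (r′ ≟ r) then f r′ c else 0) ≡ ∑[ c < n ] f r c
sum-select-row f r =
  trans (∑-comm λ r′ c → if does (r′ ≟ r) then f r′ c else 0) (sum-select-col (λ c r′ → f r′ c) r)

-- The bipartite multigraph of cells

module _ {n k} (A B : Array n k) where

  open Euler (_≟ᵥ_ {n} {k})

  -- The row end comes first, so the bit `true` directs a cell from its row vertex to its column
  -- vertex.
  cell : Fin n → Fin n → Edge
  cell r c = inj₁ (r , A r c) , inj₂ (c , B r c)

  cells : Vector Edge (n * n)
  cells = uncurry cell ∘ remQuot n

  sum-cells : ∀ {X : Set} (xs : Vector X (n * n)) (f : X → Edge → ℕ) →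
    sum (λ i → f (xs i) (cells i)) ≡ ∑[ r < n ] ∑[ c < n ] f (xs (combine r c)) (cell r c)
  sum-cells xs f = trans (sum-combine n _)
    (sum-cong-≗ λ r → sum-cong-≗ λ c → cong (f (xs (combine r c)) ∘ uncurry cell) (remQuot-combine r c))

  -- One computation serves all three degrees at a row vertex: `g` says for which bits the row end
  -- is counted. It is constantly `true` for the degree, `id` for the outdegree and `not` for the
  -- indegree.
  sum-row : ∀ xs (f : Bool → Edge → ℕ) (g : Bool → Bool) r i →
    (∀ b r′ c → f b (cell r′ c) ≡ (if does (r′ ≟ r) then ⟦ g b ∧ does (A r′ c ≟ i) ⟧ else 0)) →
    sum (λ e → f (xs e) (cells e)) ≡ ∑[ c < n ] ⟦ g (xs (combine r c)) ∧ does (A r c ≟ i) ⟧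
  sum-row xs f g r i f≡ = begin
    sum (λ e → f (xs e) (cells e))
      ≡⟨ sum-cells xs f ⟩
    ∑[ r′ < n ] ∑[ c < n ] f (xs (combine r′ c)) (cell r′ c)
      ≡⟨ sum-cong-≗ (λ r′ → sum-cong-≗ λ c → f≡ (xs (combine r′ c)) r′ c) ⟩
    ∑[ r′ < n ] ∑[ c < n ] (if does (r′ ≟ r) then ⟦ g (xs (combine r′ c)) ∧ does (A r′ c ≟ i) ⟧ else 0)
      ≡⟨ sum-select-row (λ r′ c → ⟦ g (xs (combine r′ c)) ∧ does (A r′ c ≟ i) ⟧) r ⟩
    ∑[ c < n ] ⟦ g (xs (combine r c)) ∧ does (A r c ≟ i) ⟧
      ∎

  sum-col : ∀ xs (f : Bool → Edge → ℕ) (g : Bool → Bool) c j →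
    (∀ b r c′ → f b (cell r c′) ≡ (if does (c′ ≟ c) then ⟦ g b ∧ does (B r c′ ≟ j) ⟧ else 0)) →
    sum (λ e → f (xs e) (cells e)) ≡ ∑[ r < n ] ⟦ g (xs (combine r c)) ∧ does (B r c ≟ j) ⟧
  sum-col xs f g c j f≡ = begin
    sum (λ e → f (xs e) (cells e))
      ≡⟨ sum-cells xs f ⟩
    ∑[ r < n ] ∑[ c′ < n ] f (xs (combine r c′)) (cell r c′)
      ≡⟨ sum-cong-≗ (λ r → sum-cong-≗ λ c′ → f≡ (xs (combine r c′)) r c′) ⟩
    ∑[ r < n ] ∑[ c′ < n ] (if does (c′ ≟ c) then ⟦ g (xs (combine r c′)) ∧ does (B r c′ ≟ j) ⟧ else 0)
      ≡⟨ sum-select-col (λ r c′ → ⟦ g (xs (combine r c′)) ∧ does (B r c′ ≟ j) ⟧) c ⟩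
    ∑[ r < n ] ⟦ g (xs (combine r c)) ∧ does (B r c ≟ j) ⟧
      ∎

  if-∧ : ∀ p b → ⟦ p ∧ b ⟧ ≡ (if p then ⟦ b ⟧ else 0)
  if-∧ true  b = refl
  if-∧ false b = refl

  if-0 : ∀ p → 0 ≡ (if p then 0 else 0)
  if-0 true  = refl
  if-0 false = refl

  -- The degree of the vertex `(r , i)` is the number of occurrences of `i` in row `r` of `A`, and
  -- likewise for columns of `B`.
  cells-even : (∀ r i → 2 ∣ count (A r) i) → (∀ c j → 2 ∣ count (λ r → B r c) j) →
               ∀ w → 2 ∣ degree cells w
  cells-even evenA evenB w@(inj₁ (r , i)) = subst (2 ∣_) (sym (trans
    (sum-row (λ _ → true) (λ _ e → δ w (proj₁ e) + δ w (proj₂ e)) (λ _ → true) r i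
      λ _ r′ c → trans (+-identityʳ _) (if-∧ (does (r′ ≟ r)) (does (A r′ c ≟ i))))
    (sym (length-filter-tabulate (λ c → A r c ≟ i) id)))) (evenA r i)
  cells-even evenA evenB w@(inj₂ (c , j)) = subst (2 ∣_) (sym (trans
    (sum-col (λ _ → true) (λ _ e → δ w (proj₁ e) + δ w (proj₂ e)) (λ _ → true) c j
      λ _ r c′ → if-∧ (does (c′ ≟ c)) (does (B r c′ ≟ j)))
    (sym (length-filter-tabulate (λ r → B r c ≟ j) id)))) (evenB c j)

  balanced-split : (∀ r i → 2 ∣ count (A r) i) → (∀ c j → 2 ∣ count (λ r → B r c) j) →
    Σ (Fin n → Fin n → Bool) λ X →
      (∀ r i → ∑[ c < n ] ⟦ X r c ∧ does (A r c ≟ i) ⟧ ≡ ∑[ c < n ] ⟦ not (X r c) ∧ does (A r c ≟ i) ⟧) ×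
      (∀ c j → ∑[ r < n ] ⟦ X r c ∧ does (B r c ≟ j) ⟧ ≡ ∑[ r < n ] ⟦ not (X r c) ∧ does (B r c ≟ j) ⟧)
  balanced-split evenA evenB with xs , flow ← eulerian cells (cells-even evenA evenB) =
    (λ r c → xs (combine r c)) , rows , cols
    where
    rows : ∀ r i → _
    rows r i = begin
      _ ≡⟨ sum-row xs (λ b e → δ w (tail b e)) id r i
             (λ { true  r′ c → if-∧ (does (r′ ≟ r)) (does (A r′ c ≟ i))
                ; false r′ c → if-0 (does (r′ ≟ r)) }) ⟨
      outdegree xs cells w ≡⟨ flow w ⟩
      indegree xs cells w
        ≡⟨ sum-row xs (λ b e → δ w (head b e)) not r i
             (λ { true  r′ c → if-0 (does (r′ ≟ r))
                ; false r′ c → if-∧ (does (r′ ≟ r)) (does (A r′ c ≟ i)) }) ⟩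
      _ ∎
      where w = inj₁ (r , i)
    cols : ∀ c j → _
    -- Edges with bit `true` enter their column vertex, so here `id` goes with the indegree, `not`
    -- with the outdegree, and the flow equation is read backwards.
    cols c j = begin
      _ ≡⟨ sum-col xs (λ b e → δ w (head b e)) id c j
             (λ { true  r c′ → if-∧ (does (c′ ≟ c)) (does (B r c′ ≟ j))
                ; false r c′ → if-0 (does (c′ ≟ c)) }) ⟨
      indegree xs cells w ≡⟨ flow w ⟨
      outdegree xs cells w
        ≡⟨ sum-col xs (λ b e → δ w (tail b e)) not c j
             (λ { true  r c′ → if-0 (does (c′ ≟ c))
                ; false r c′ → if-∧ (does (c′ ≟ c)) (does (B r c′ ≟ j)) }) ⟩
      _ ∎
      where w = inj₂ (c , j)

-- Counts along a single row or column

symbol : Bool → Fin 2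
symbol b = if b then 0F else 1F

module _ {n q} (x : Vector Bool n) (a : Vector (Fin 2) n)
  (count-a : ∀ i → count a i ≡ 2 * q)
  (balanced : ∀ i → ∑[ c < n ] ⟦ x c ∧ does (a c ≟ i) ⟧ ≡ ∑[ c < n ] ⟦ not (x c) ∧ does (a c ≟ i) ⟧) where

  private
    -- The cells with symbol `i` in `a` number `2 * q` and are split by `x` into two classes of
    -- equal size.
    positive-half : ∀ i → ∑[ c < n ] ⟦ x c ∧ does (a c ≟ i) ⟧ ≡ q
    positive-half i = *-cancelˡ-≡ _ _ 2 (begin
      2 * P                    ≡⟨ cong (P +_) (+-identityʳ P) ⟩
      P + P                    ≡⟨ cong (P +_) (balanced i) ⟩
      P + sum (λ c → ⟦ not (x c) ∧ does (a c ≟ i) ⟧)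
        ≡⟨ ∑-distrib-+ (λ c → ⟦ x c ∧ does (a c ≟ i) ⟧) (λ c → ⟦ not (x c) ∧ does (a c ≟ i) ⟧) ⟨
      ∑[ c < n ] (⟦ x c ∧ does (a c ≟ i) ⟧ + ⟦ not (x c) ∧ does (a c ≟ i) ⟧)
        ≡⟨ sum-cong-≗ (λ c → split (x c) (does (a c ≟ i))) ⟩
      ∑[ c < n ] ⟦ does (a c ≟ i) ⟧
        ≡⟨ length-filter-tabulate (λ c → a c ≟ i) id ⟨
      count a i                ≡⟨ count-a i ⟩
      2 * q                    ∎)
      where
      P = ∑[ c < n ] ⟦ x c ∧ does (a c ≟ i) ⟧
      split : ∀ b p → ⟦ b ∧ p ⟧ + ⟦ not b ∧ p ⟧ ≡ ⟦ p ⟧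
      split true  p = +-identityʳ _
      split false p = refl

  joint-count : ∀ s i → ∑[ c < n ] ⟦ does (symbol (x c) ≟ s) ∧ does (a c ≟ i) ⟧ ≡ q
  joint-count 0F i = trans (sum-cong-≗ λ c → cong (λ b → ⟦ b ∧ does (a c ≟ i) ⟧) (is0 (x c))) (positive-half i)
    where
    is0 : ∀ b → does (symbol b ≟ 0F) ≡ b
    is0 true  = refl
    is0 false = refl
  joint-count 1F i = trans (sum-cong-≗ λ c → cong (λ b → ⟦ b ∧ does (a c ≟ i) ⟧) (is1 (x c)))
                           (trans (sym (balanced i)) (positive-half i))
    where
    is1 : ∀ b → does (symbol b ≟ 1F) ≡ not b
    is1 true  = refl
    is1 false = refl

  -- Since `a` takes only the symbols 0 and 1, the cells marked `s` split into two joint counts,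
  -- each equal to `q`.
  line-count : ∀ s → count (symbol ∘ x) s ≡ 2 * q
  line-count s = begin
    count (symbol ∘ x) s
      ≡⟨ length-filter-tabulate (λ c → symbol (x c) ≟ s) id ⟩
    ∑[ c < n ] ⟦ does (symbol (x c) ≟ s) ⟧
      ≡⟨ sum-cong-≗ (λ c → split (a c) (does (symbol (x c) ≟ s))) ⟩
    ∑[ c < n ] (⟦ does (symbol (x c) ≟ s) ∧ does (a c ≟ 0F) ⟧ + ⟦ does (symbol (x c) ≟ s) ∧ does (a c ≟ 1F) ⟧)
      ≡⟨ ∑-distrib-+ (λ c → ⟦ does (symbol (x c) ≟ s) ∧ does (a c ≟ 0F) ⟧)
                     (λ c → ⟦ does (symbol (x c) ≟ s) ∧ does (a c ≟ 1F) ⟧) ⟩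
    _ ≡⟨ cong₂ _+_ (joint-count s 0F) (joint-count s 1F) ⟩
    q + q ≡⟨ cong (q +_) (+-identityʳ q) ⟨
    2 * q ∎
    where
    split : ∀ i b → ⟦ b ⟧ ≡ ⟦ b ∧ does (i ≟ 0F) ⟧ + ⟦ b ∧ does (i ≟ 1F) ⟧
    split 0F true  = refl
    split 0F false = refl
    split 1F true  = refl
    split 1F false = refl

-- Assembling the orthogonal square

binary : ∀ {k} → k ≡ 2 → ∀ q → let n = 2 * (2 * q) in (A B : Array n k) →
  (∀ r i → count (A r) i ≡ 2 * q) → (∀ c j → count (λ r → B r c) j ≡ 2 * q) →
  Σ (Array n k) λ F →
    ((∀ r s → count (F r) s ≡ 2 * q) × (∀ c s → count (λ r → F r c) s ≡ 2 * q)) ×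
    (∀ s i → pairCount F A s i ≡ 2 * q * (2 * q)) ×
    (∀ s j → pairCount F B s j ≡ 2 * q * (2 * q))
-- The number of symbols, `2 * m / m` in the application, does not reduce to 2 for symbolic `m`.
-- Keeping it as a variable `k` lets one match on `refl` turn both arrays into binary ones without
-- transports.
binary refl q A B countA countB
  with X , rows , cols ← balanced-split A B (λ r i → subst (2 ∣_) (sym (countA r i)) (m∣m*n q))
                                            (λ c j → subst (2 ∣_) (sym (countB c j)) (m∣m*n q))
  = F
  , ( (λ r → line-count {q = q} (X r) (A r) (countA r) (rows r))
    , (λ c → line-count {q = q} (λ r → X r c) (λ r → B r c) (countB c) (cols c)))
  , (λ s i → begin
      pairCount F A s i
        ≡⟨ pairs A s i ⟩
      ∑[ r < n ] ∑[ c < n ] ⟦ does (F r c ≟ s) ∧ does (A r c ≟ i) ⟧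
        ≡⟨ sum-cong-≗ (λ r → joint-count (X r) (A r) (countA r) (rows r) s i) ⟩
      ∑[ r < n ] q
        ≡⟨ total ⟩
      2 * q * (2 * q) ∎)
  , (λ s j → begin
      pairCount F B s j
        ≡⟨ pairs B s j ⟩
      ∑[ r < n ] ∑[ c < n ] ⟦ does (F r c ≟ s) ∧ does (B r c ≟ j) ⟧
        -- Balance with respect to `B` holds down each column, so the column sum has to be the outer
        -- one before `joint-count` applies.
        ≡⟨ ∑-comm (λ r c → ⟦ does (F r c ≟ s) ∧ does (B r c ≟ j) ⟧) ⟩
      ∑[ c < n ] ∑[ r < n ] ⟦ does (F r c ≟ s) ∧ does (B r c ≟ j) ⟧
        ≡⟨ sum-cong-≗ (λ c → joint-count (λ r → X r c) (λ r → B r c) (countB c) (cols c) s j) ⟩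
      ∑[ c < n ] q
        ≡⟨ total ⟩
      2 * q * (2 * q) ∎)
  where
  n = 2 * (2 * q)
  F : Array n 2
  F r c = symbol (X r c)
  pairs : ∀ G s i → pairCount F G s i ≡ ∑[ r < n ] ∑[ c < n ] ⟦ does (F r c ≟ s) ∧ does (G r c ≟ i) ⟧
  pairs G s i = length-filter-cartesianProduct
    (λ rc → (F (proj₁ rc) (proj₂ rc) ≟ s) ×-dec (G (proj₁ rc) (proj₂ rc) ≟ i)) id id
  total : ∑[ r < n ] q ≡ 2 * q * (2 * q)
  total = trans (sum-const n q) (square q)
    where
    square : ∀ q → 2 * (2 * q) * q ≡ 2 * q * (2 * q)
    square = solve-∀

theorem5p1 : (h : ℕ) →
    let m = 2 * suc h in
    (F₁ F₂ : Array (2 * m) (2 * m / m)) →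
    IsFreqSquare (2 * m) m F₁ → IsFreqSquare (2 * m) m F₂ →
    Orthogonal (2 * m) m F₁ F₂ →
    Σ (Array (2 * m) (2 * m / m)) λ F →
      IsFreqSquare (2 * m) m F × Orthogonal (2 * m) m F F₁ × Orthogonal (2 * m) m F F₂
theorem5p1 h F₁ F₂ (rows₁ , _) (_ , cols₂) _ =
  binary (m*n/n≡m 2 (2 * suc h)) (suc h) F₁ F₂ rows₁ cols₂
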